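{- Let $\sigma = 2$. For every Parikh vector $P \in \mathbb{N}_0^{2}$ and every word $w \in \Sigma^{*|_P}$, there exists a Hamiltonian path in the configuration graph $G(P)$ starting at $w$.
   Context: Alphabet $\Sigma = \{1,2\}$. For $P \in \mathbb{N}_0^2$, $n := P[1]+P[2]$ and $\Sigma^{*|_P}$ is the set of words of length $n$ with exactly $P[1]$ occurrences of $1$ and $P[2]$ occurrences of $2$. For a word $w$ and $i\neq j$ with $w[i]\neq w[j]$, the 2-swap $w\circ(i,j)$ exchanges the symbols at positions $i$ and $j$. The configuration graph $G(P)$ has vertex set $\Sigma^{*|_P}$ and an edge $\{w,u\}$ whenever $u = w\circ(i,j)$ for some 2-swap. A Hamiltonian path starting at $w$ is a path beginning at $w$ that visits every vertex exactly once. -}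

module Defs where

open import Data.Fin using (Fin; _≟_)
open import Data.List using (List; _∷_)
open import Data.List.Membership.Propositional using (_∈_)
open import Data.List.Relation.Unary.Linked using (Linked)
open import Data.List.Relation.Unary.Unique.Propositional using (Unique)
open import Data.Nat using (ℕ)
open import Data.Product using (Σ; ∃-syntax; _×_; _,_; proj₁)
open import Data.Vec using (Vec; count; lookup; sum; tabulate; _[_]≔_)
open import Data.Vec.Properties using (lookup∘update; lookup∘update′; []≔-commutes; []≔-idempotent; []≔-lookup)
open import Function using (_∘_)
open import Level using (0ℓ)
open import Relation.Binary.Core using (Rel)
open import Relation.Binary.Definitions using (Irreflexive; Symmetric)
open import Relation.Binary.PropositionalEquality using (_≡_; _≢_; refl; sym; trans; cong; cong₂; subst₂; module ≡-Reasoning)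

record Graph : Set₁ where
  field
    Vertex : Set
    Edge   : Rel Vertex 0ℓ
    symm   : Symmetric Edge
    irrefl : Irreflexive _≡_ Edge

module _ (G : Graph) where
  open Graph G

  IsPath : List Vertex → Set
  IsPath p = Linked Edge p × Unique p

  HamiltonianPathFrom : Vertex → Set
  HamiltonianPathFrom v =
    ∃[ vs ] (IsPath (v ∷ vs) × (∀ u → u ∈ v ∷ vs))

-- The alphabet {1,…,σ} is represented by Fin σ, the symbol k being the
-- element of Fin σ with index k - 1; likewise for positions in a word.
Word : ℕ → ℕ → Set
Word σ n = Vec (Fin σ) n

ParikhVector : ℕ → Set
ParikhVector σ = Vec ℕ σ

parikh : ∀ {σ n} → Word σ n → ParikhVector σ
parikh w = tabulate (λ a → count (a ≟_) w)

WordWith : ∀ {σ} → ParikhVector σ → Set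
WordWith {σ} P = Σ (Word σ (sum P)) λ w → parikh w ≡ P

swap : ∀ {σ n} → Word σ n → Fin n → Fin n → Word σ n
swap w i j = (w [ i ]≔ lookup w j) [ j ]≔ lookup w i

_⟶_ : ∀ {σ n} → Word σ n → Word σ n → Set
w ⟶ u = ∃[ i ] ∃[ j ] (i ≢ j × lookup w i ≢ lookup w j × u ≡ swap w i j)

module _ {σ n} (w : Word σ n) {i j : Fin n} (i≢j : i ≢ j) where

  lookup-swapˡ : lookup (swap w i j) i ≡ lookup w j
  lookup-swapˡ = trans (lookup∘update′ i≢j (w [ i ]≔ lookup w j) (lookup w i))
                       (lookup∘update i w (lookup w j))

  lookup-swapʳ : lookup (swap w i j) j ≡ lookup w i
  lookup-swapʳ = lookup∘update j (w [ i ]≔ lookup w j) (lookup w i)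

  swap-involutive : swap (swap w i j) i j ≡ w
  swap-involutive = begin
    (swap w i j [ i ]≔ lookup (swap w i j) j) [ j ]≔ lookup (swap w i j) i
      ≡⟨ cong₂ (λ a b → (swap w i j [ i ]≔ a) [ j ]≔ b) lookup-swapʳ lookup-swapˡ ⟩
    (((w [ i ]≔ wj) [ j ]≔ wi) [ i ]≔ wi) [ j ]≔ wj
      ≡⟨ cong (_[ j ]≔ wj) ([]≔-commutes (w [ i ]≔ wj) j i (i≢j ∘ sym)) ⟩
    (((w [ i ]≔ wj) [ i ]≔ wi) [ j ]≔ wi) [ j ]≔ wj
      ≡⟨ []≔-idempotent ((w [ i ]≔ wj) [ i ]≔ wi) j ⟩
    ((w [ i ]≔ wj) [ i ]≔ wi) [ j ]≔ wj
      ≡⟨ cong (_[ j ]≔ wj) (trans ([]≔-idempotent w i) ([]≔-lookup w i)) ⟩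
    w [ j ]≔ wj
      ≡⟨ []≔-lookup w j ⟩
    w ∎
    where
    open ≡-Reasoning
    wi = lookup w i
    wj = lookup w j

⟶-sym : ∀ {σ n} → Symmetric (_⟶_ {σ} {n})
⟶-sym {x = w} (i , j , i≢j , wi≢wj , refl) =
  i , j , i≢j
  , subst₂ _≢_ (sym (lookup-swapˡ w i≢j)) (sym (lookup-swapʳ w i≢j)) (wi≢wj ∘ sym)
  , sym (swap-involutive w i≢j)

⟶-irrefl : ∀ {σ n} → Irreflexive _≡_ (_⟶_ {σ} {n})
⟶-irrefl {x = w} refl (i , j , i≢j , wi≢wj , w≡swap) =
  wi≢wj (trans (cong (λ v → lookup v i) w≡swap) (lookup-swapˡ w i≢j))

configurationGraph : ∀ {σ} → ParikhVector σ → Graph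
configurationGraph P = record
  { Vertex = WordWith P
  ; Edge   = λ w u → proj₁ w ⟶ proj₁ u
  ; symm   = ⟶-sym
  ; irrefl = ⟶-irrefl ∘ cong proj₁
  }

{-# OPTIONS --safe #-}

-- By induction on the length, uniformly in the starting word a w′.  A path
-- from w′, prefixed by a, exhausts the words beginning with a and stops at some
-- a v′.  If v′ contains the other letter b, exchanging that occurrence with the
-- leading a gives a word b u′, and a path from u′, prefixed by b, exhausts the
-- rest.  If it does not, no word of this Parikh vector begins with b.

module Submission where

open import Data.Bool using (true; false)
open import Data.Fin using (Fin; zero; suc; _≟_)
open import Data.Fin.Properties using (any?)
open import Data.List using (List; []; _∷_; _++_; map; last)
open import Data.List.Membership.Propositional using (_∈_)
open import Data.List.Membership.Propositional.Properties using (∈-map⁺; ∈-map⁻; ∈-++⁺ˡ; ∈-++⁺ʳ; ∈-++⁻)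
open import Data.List.Properties using (last-map)
open import Data.List.Relation.Unary.All as All using (All; []; _∷_)
open import Data.List.Relation.Unary.Any using (here; there)
open import Data.List.Relation.Unary.Linked as Linked using (Linked; [-])
open import Data.List.Relation.Unary.Linked.Properties as Linkedₚ using ()
open import Data.List.Relation.Unary.Unique.Propositional using (Unique; []; _∷_)
open import Data.List.Relation.Unary.Unique.Propositional.Properties as Uniqueₚ using ()
open import Data.Maybe as Maybe using (just)
open import Data.Maybe.Relation.Binary.Connected using (Connected; just)
open import Data.Nat using (ℕ; suc)
open import Data.Nat.Properties using (suc-injective)
open import Data.Product using (∃-syntax; _×_; _,_; proj₁)
open import Data.Sum using (inj₁; inj₂)
open import Data.Vec using ([]; _∷_; count; head; lookup; _[_]≔_)
open import Data.Vec.Properties using (lookup∘tabulate; tabulate-cong; ∷-injectiveʳ)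
open import Function using (_∘_)
open import Relation.Binary.PropositionalEquality using (_≡_; _≢_; refl; sym; trans; cong; subst; ≢-sym)
open import Relation.Binary.PropositionalEquality.WithK using (≡-irrelevant)
open import Relation.Nullary using (yes; no; does; contradiction; ¬?)
open import Relation.Nullary.Decidable using (dec-true)

open import Defs

private
  variable
    σ n : ℕ

infix 4 _≈_

-- A record, so that u and w can be inferred from a proof of u ≈ w.
record _≈_ {σ n : ℕ} (u w : Word σ n) : Set where
  field
    count-≡ : ∀ c → count (c ≟_) u ≡ count (c ≟_) w

open _≈_

≈-refl : {w : Word σ n} → w ≈ w
≈-refl .count-≡ c = refl

≈-sym : {u w : Word σ n} → u ≈ w → w ≈ u
≈-sym u≈w .count-≡ c = sym (u≈w .count-≡ c)

≈-trans : {u v w : Word σ n} → u ≈ v → v ≈ w → u ≈ w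
≈-trans u≈v v≈w .count-≡ c = trans (u≈v .count-≡ c) (v≈w .count-≡ c)

≈⇒parikh≡ : {u w : Word σ n} → u ≈ w → parikh u ≡ parikh w
≈⇒parikh≡ u≈w = tabulate-cong (u≈w .count-≡)

parikh≡⇒≈ : {u w : Word σ n} → parikh u ≡ parikh w → u ≈ w
parikh≡⇒≈ {u = u} {w} eq .count-≡ c =
  trans (sym (lookup∘tabulate (λ a → count (a ≟_) u) c))
        (trans (cong (λ p → lookup p c) eq)
               (lookup∘tabulate (λ a → count (a ≟_) w) c))

∷-cong-≈ : (a : Fin σ) {u w : Word σ n} → u ≈ w → a ∷ u ≈ a ∷ w
∷-cong-≈ a u≈w .count-≡ c with does (c ≟ a)
... | true  = cong suc (u≈w .count-≡ c)
... | false = u≈w .count-≡ c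

∷-cancel-≈ : (a : Fin σ) {u w : Word σ n} → a ∷ u ≈ a ∷ w → u ≈ w
∷-cancel-≈ a au≈aw .count-≡ c with does (c ≟ a) | au≈aw .count-≡ c
... | true  | eq = suc-injective eq
... | false | eq = eq

∷-swap-≈ : (a b : Fin σ) (w : Word σ n) → a ∷ b ∷ w ≈ b ∷ a ∷ w
∷-swap-≈ a b w .count-≡ c with does (c ≟ a) | does (c ≟ b)
... | true  | true  = refl
... | true  | false = refl
... | false | true  = refl
... | false | false = refl

-- Ensures that the block entered by the exchange stays within the same letter counts. Exchanging
-- the two leading letters is enough: bring `b` to the front, recurse behind it, and move it back.
swap-head-≈ : (a : Fin σ) (w : Word σ n) (j : Fin n) →
              lookup w j ∷ (w [ j ]≔ a) ≈ a ∷ w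
swap-head-≈ a (b ∷ w) zero    = ∷-swap-≈ b a w
swap-head-≈ a (b ∷ w) (suc j) =
  ≈-trans (∷-swap-≈ (lookup w j) b (w [ j ]≔ a))
          (≈-trans (∷-cong-≈ b (swap-head-≈ a w j)) (∷-swap-≈ b a w))

swap-head-⟶ : {a : Fin σ} (w : Word σ n) (j : Fin n) → lookup w j ≢ a →
              (a ∷ w) ⟶ (lookup w j ∷ (w [ j ]≔ a))
-- The final `refl` holds because `swap` at `zero` and `suc j` computes to exactly this word.
swap-head-⟶ w j wj≢a = zero , suc j , (λ ()) , ≢-sym wj≢a , refl

∷-⟶ : (a : Fin σ) {u w : Word σ n} → u ⟶ w → (a ∷ u) ⟶ (a ∷ w)
∷-⟶ a (i , j , i≢j , ui≢uj , refl) =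
  suc i , suc j , (λ { refl → i≢j refl }) , ui≢uj , refl

count≡suc⇒occurs : (c : Fin σ) (w : Word σ n) {k : ℕ} →
                   count (c ≟_) w ≡ suc k → ∃[ j ] lookup w j ≡ c
count≡suc⇒occurs c (a ∷ w) eq with c ≟ a
... | yes c≡a = zero , sym c≡a
... | no _    = let j , wj≡c = count≡suc⇒occurs c w eq in suc j , wj≡c

head-occurs : {c : Fin σ} {u : Word σ n} {w : Word σ (suc n)} →
              c ∷ u ≈ w → ∃[ j ] lookup w j ≡ c
head-occurs {c = c} {u} {w} cu≈w =
  count≡suc⇒occurs c w (trans (sym (cu≈w .count-≡ c)) count-head)
  where
  count-head : count (c ≟_) (c ∷ u) ≡ suc (count (c ≟_) u)
  count-head rewrite dec-true (c ≟ c) refl = refl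

-- The one place where the alphabet has to be binary: all words not beginning with `a` share their
-- first letter, so two blocks cover everything.
≢-≢⇒≡ : {a b c : Fin 2} → b ≢ a → c ≢ a → c ≡ b
≢-≢⇒≡ {zero}     {zero}              b≢a _   = contradiction refl b≢a
≢-≢⇒≡ {zero}     {suc zero} {zero}     _ c≢a = contradiction refl c≢a
≢-≢⇒≡ {zero}     {suc zero} {suc zero} _ _   = refl
≢-≢⇒≡ {suc zero} {suc zero}          b≢a _   = contradiction refl b≢a
≢-≢⇒≡ {suc zero} {zero} {suc zero}     _ c≢a = contradiction refl c≢a
≢-≢⇒≡ {suc zero} {zero} {zero}         _ _   = refl

-- Membership gives the final word of a tour the letter counts of its start; the `last` equation
-- allows another block to be attached there.
last-∷ : {A : Set} (x : A) (xs : List A) →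
         ∃[ y ] (y ∈ x ∷ xs × last (x ∷ xs) ≡ just y)
last-∷ x []       = x , here refl , refl
last-∷ x (y ∷ xs) = let z , z∈ , eq = last-∷ y xs in z , there z∈ , eq

-- A Hamiltonian path on bare words. The vertex set is the `≈`-class of the start rather than a
-- fixed Parikh vector, since the two recursive tours run over tails with different letter counts.
record Tour (w : Word σ n) : Set where
  field
    rest     : List (Word σ n)
    linked   : Linked _⟶_ (w ∷ rest)
    unique   : Unique (w ∷ rest)
    sound    : ∀ {u} → u ∈ w ∷ rest → u ≈ w
    complete : ∀ {u} → u ≈ w → u ∈ w ∷ rest

  words : List (Word σ n)
  words = w ∷ rest

module _ {w : Word σ n} (T : Tour w) (a : Fin σ) where
  open Tour T

  prefix-linked : Linked _⟶_ (map (a ∷_) words)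
  prefix-linked = Linkedₚ.map⁺ (Linked.map (∷-⟶ a) linked)

  prefix-unique : Unique (map (a ∷_) words)
  prefix-unique = Uniqueₚ.map⁺ ∷-injectiveʳ unique

  prefix-sound : ∀ {u} → u ∈ map (a ∷_) words → u ≈ a ∷ w
  prefix-sound u∈ with _ , x∈ , refl ← ∈-map⁻ (a ∷_) u∈ = ∷-cong-≈ a (sound x∈)

  prefix-complete : ∀ {u} → a ∷ u ≈ a ∷ w → a ∷ u ∈ map (a ∷_) words
  prefix-complete = ∈-map⁺ (a ∷_) ∘ complete ∘ ∷-cancel-≈ a

  prefix-head : ∀ {u} → u ∈ map (a ∷_) words → head u ≡ a
  prefix-head u∈ with _ , _ , refl ← ∈-map⁻ (a ∷_) u∈ = refl

tour : (w : Word 2 n) → Tour w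
tour [] = record
  { rest     = []
  ; linked   = [-]
  ; unique   = [] ∷ []
  ; sound    = λ { (here refl) → ≈-refl }
  ; complete = λ { {[]} _ → here refl }
  }
tour {suc n} (a ∷ w) with tour w
... | T with last-∷ w (Tour.rest T)
... | v , v∈ , last≡v with any? (λ j → ¬? (lookup v j ≟ a))
... | no ∄j = record
  { rest     = map (a ∷_) (Tour.rest T)
  ; linked   = prefix-linked T a
  ; unique   = prefix-unique T a
  ; sound    = prefix-sound T a
  ; complete = complete
  }
  where
  complete : ∀ {u} → u ≈ a ∷ w → u ∈ map (a ∷_) (Tour.words T)
  complete {c ∷ u} cu≈aw with c ≟ a
  ... | yes refl = prefix-complete T a cu≈aw
  ... | no c≢a
    -- Since `a ∷ v` has the same counts, `c` would have to occur in it; but all its letters are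
    -- `a`.
    with head-occurs (≈-trans cu≈aw (≈-sym (∷-cong-≈ a (Tour.sound T v∈))))
  ...   | zero  , a≡c  = contradiction (sym a≡c) c≢a
  ...   | suc j , vj≡c = contradiction (j , c≢a ∘ trans (sym vj≡c)) ∄j
... | yes (j , b≢a) = record
  { rest     = map (a ∷_) (Tour.rest T) ++ bs
  ; linked   = Linkedₚ.++⁺ (prefix-linked T a) junction (prefix-linked U b)
  ; unique   = Uniqueₚ.++⁺ (prefix-unique T a) (prefix-unique U b)
                 (λ (∈as , ∈bs) → b≢a (trans (sym (prefix-head U b ∈bs)) (prefix-head T a ∈as)))
  ; sound    = sound
  ; complete = complete
  }
  where
  b  = lookup v j
  -- Not a subterm of the input: the recursion descends on the length.
  U  = tour (v [ j ]≔ a)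
  as = map (a ∷_) (Tour.words T)
  bs = map (b ∷_) (Tour.words U)

  bu≈aw : b ∷ (v [ j ]≔ a) ≈ a ∷ w
  bu≈aw = ≈-trans (swap-head-≈ a v j) (∷-cong-≈ a (Tour.sound T v∈))

  -- The only edge not inherited from a shorter tour: it leads from the last word of `as` to the
  -- first of `bs`.
  junction : Connected _⟶_ (last as) (just (b ∷ (v [ j ]≔ a)))
  junction = subst (λ l → Connected _⟶_ l (just (b ∷ (v [ j ]≔ a)))) (sym last-as)
                   (just (swap-head-⟶ v j b≢a))
    where
    last-as : last as ≡ just (a ∷ v)
    last-as = trans (last-map (a ∷_) (Tour.words T)) (cong (Maybe.map (a ∷_)) last≡v)

  sound : ∀ {u} → u ∈ as ++ bs → u ≈ a ∷ w
  sound u∈ with ∈-++⁻ as u∈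
  ... | inj₁ ∈as = prefix-sound T a ∈as
  ... | inj₂ ∈bs = ≈-trans (prefix-sound U b ∈bs) bu≈aw

  complete : ∀ {u} → u ≈ a ∷ w → u ∈ as ++ bs
  complete {c ∷ u} cu≈aw with c ≟ a
  ... | yes refl = ∈-++⁺ˡ (prefix-complete T a cu≈aw)
  ... | no c≢a with refl ← ≢-≢⇒≡ b≢a c≢a =
    ∈-++⁺ʳ as (prefix-complete U b (≈-trans cu≈aw (≈-sym bu≈aw)))

-- Lets linkedness, uniqueness and membership be pulled back from bare words to vertices, which
-- carry a proof about their Parikh vector.
map-proj₁-toList : {A : Set} {Q : A → Set} {xs : List A} (qs : All Q xs) →
                   map proj₁ (All.toList qs) ≡ xs
map-proj₁-toList []       = refl
map-proj₁-toList (q ∷ qs) = cong (_ ∷_) (map-proj₁-toList qs)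

-- Proofs of an equation between Parikh vectors are all equal, so a vertex is determined by its
-- word.
proj₁-injective : {P : ParikhVector σ} {u w : WordWith P} → proj₁ u ≡ proj₁ w → u ≡ w
proj₁-injective {u = u , p} {.u , q} refl = cong (u ,_) (≡-irrelevant p q)

theorem2 : ∀ (P : ParikhVector 2) (w : WordWith P) →
    HamiltonianPathFrom (configurationGraph P) w
theorem2 P (w , w∈P) =
  All.toList rest∈P
  , ( Linkedₚ.map⁻ (subst (Linked _⟶_) (sym forget) linked)
    , Uniqueₚ.map⁻ (subst Unique (sym forget) unique) )
  , visits
  where
  open Tour (tour w)

  rest∈P : All (λ u → parikh u ≡ P) rest
  rest∈P = All.tabulate (λ u∈ → trans (≈⇒parikh≡ (sound (there u∈))) w∈P)

  forget : map proj₁ (All.toList (w∈P ∷ rest∈P)) ≡ words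
  forget = map-proj₁-toList (w∈P ∷ rest∈P)

  visits : ∀ u → u ∈ (w , w∈P) ∷ All.toList rest∈P
  visits (u , u∈P)
    -- Completeness only yields some listed vertex `x` with the word `u`; injectivity identifies it
    -- with the given vertex.
    with x , x∈ , u≡x ← ∈-map⁻ proj₁ (subst (u ∈_) (sym forget)
                          (complete (parikh≡⇒≈ (trans u∈P (sym w∈P)))))
    with refl ← proj₁-injective {u = u , u∈P} {x} u≡x = x∈
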